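{- There are infinitely many positive integers $n$ such that, among the subsets of $D_n=\{d\geqslant 2: d\mid n\}$, only $D_n$ itself can be the set of all the moduli in a cover of $\mathbb{Z}$ with distinct moduli; that is, $D_n$ is the set of all moduli of some cover of $\mathbb{Z}$ with distinct moduli, while no proper subset of $D_n$ is the set of all moduli of a cover of $\mathbb{Z}$ with distinct moduli.
   Context: For $a\in\mathbb{Z}$ and a positive integer $n$, $a(\mathrm{mod}\ n)=\{a+nx: x\in\mathbb{Z}\}$ is the residue class with modulus $n$. A finite system of residue classes $\{a_i(\mathrm{mod}\ n_i)\}_{i=1}^k$ is a cover of $\mathbb{Z}$ if every integer lies in at least one of the classes $a_i(\mathrm{mod}\ n_i)$; the integers $n_1,\ldots,n_k$ are its moduli. The cover has distinct moduli if $n_1,\ldots,n_k$ are pairwise distinct. -}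

module Defs where

open import Data.Fin.Base using (Fin)
open import Data.Integer.Base using (ℤ; +_; _+_; _*_)
open import Data.Nat.Base using (ℕ; _≤_; _<_)
open import Data.Nat.Divisibility using (_∣_)
open import Data.Product.Base using (_×_; ∃-syntax)
open import Function.Definitions using (Injective)
open import Level using (0ℓ)
open import Relation.Binary.PropositionalEquality.Core using (_≡_)
open import Relation.Unary using (Pred; _∈_; _≐_)

infix 8 _mod_

_mod_ : ℤ → ℕ → Pred ℤ 0ℓ
(a mod n) z = ∃[ x ] z ≡ a + + n * x

record System (k : ℕ) : Set where
  field
    residue   : Fin k → ℤ
    modulus   : Fin k → ℕ
    modulus>0 : ∀ i → 0 < modulus i

  Moduli : Pred ℕ 0ℓ
  Moduli m = ∃[ i ] modulus i ≡ m

  IsCover : Set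
  IsCover = ∀ z → ∃[ i ] z ∈ residue i mod modulus i

  DistinctModuli : Set
  DistinctModuli = Injective _≡_ _≡_ modulus

open System public

-- Sets of natural numbers are predicates, compared extensionally by _≐_.
IsModuliSetOfDistinctCover : Pred ℕ 0ℓ → Set
IsModuliSetOfDistinctCover M =
  ∃[ k ] ∃[ S ] IsCover {k} S × DistinctModuli S × M ≐ Moduli S

D : ℕ → Pred ℕ 0ℓ
D n d = 2 ≤ d × d ∣ n

-- A set of natural numbers is infinite when it is unbounded.
InfinitelyMany : ∀ {ℓ} → Pred ℕ ℓ → Set ℓ
InfinitelyMany P = ∀ N → ∃[ n ] N < n × P n

{-# OPTIONS --safe #-}
-- Let p = m + 1 be an odd prime and n = 2 ^ m * p, so that the divisors of n are the 2 ^ a and the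
-- 2 ^ b * p with a, b ≤ m.
--
-- The classes 2 ^ i (mod 2 ^ (i + 1)) with i < m cover every integer except the multiples of 2 ^ m,
-- and the multiple 2 ^ m * w lies in the class of 2 ^ m * j modulo 2 ^ j * p for j = w mod p.
--
-- Conversely, let distinct divisors ≥ 2 of n be the moduli of a cover. The classes whose moduli are
-- powers of two have total density < 1, so they miss some x, hence all of x + 2 ^ m * t with t < p.
-- A class with modulus 2 ^ b * p contains at most one of these p integers, so each of the p moduli
-- 2 ^ b * p occurs and its class contains x modulo 2 ^ b. With b = m this makes x unique modulo 2 ^ m.
-- If some 2 ^ (a + 1) were not a modulus, there would be two such x, differing by 2 ^ a modulo
-- 2 ^ (a + 1).
module Submission where

open import Defs
open import Data.Fin.Base using (Fin; zero; suc; toℕ; fromℕ<; punchOut; splitAt; join)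
open import Data.Fin.Properties as Fin
  using (any?; toℕ<n; toℕ-fromℕ<; toℕ-injective; punchOut-injective; injective⇒≤;
         splitAt-join; join-splitAt)
open import Data.Integer.Base as ℤ using (ℤ; +_; ∣_∣)
import Data.Integer.Divisibility.Signed as ℤ∣
open import Data.Integer.DivMod using (_%ℕ_; _/ℕ_; n%ℕd<d; a≡a%ℕn+[a/ℕn]*n)
import Data.Integer.Properties as ℤ
open import Data.Integer.Tactic.RingSolver using (solve-∀)
open import Data.List.Base using ([]; _∷_)
open import Data.List.Relation.Unary.All using (_∷_)
open import Data.Nat.Base
  using (ℕ; zero; suc; _+_; _*_; _∸_; _^_; _!; _≤_; _<_; z≤n; s≤s; z<s; s≤s⁻¹; NonZero)
open import Data.Nat.Coprimality using (Coprime; coprime-divisor)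
open import Data.Nat.Divisibility
open import Data.Nat.Primality
open import Data.Nat.Primality.Factorisation using (factorise)
open import Data.Nat.Properties
open import Data.Product.Base using (_×_; _,_; ∃-syntax)
open import Data.Sum.Base using (_⊎_; inj₁; inj₂; [_,_]′)
open import Function.Base using (_∘_)
open import Function.Definitions using (Injective)
open import Level using (0ℓ)
open import Relation.Binary.Definitions using (tri<; tri≈; tri>)
open import Relation.Binary.PropositionalEquality
open import Relation.Nullary.Decidable using (Dec; yes; no)
import Relation.Nullary.Decidable as Dec
open import Relation.Nullary.Negation.Core using (¬_; contradiction)
open import Relation.Unary using (Pred; _∈_; _⊂_; _⊆_)

-- Pigeonhole and arbitrarily large primes.

-- A missed value `j` could be punched out of the codomain, leaving an injection from `Fin (suc n)`
-- into `Fin n`.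
injective⇒surjective : ∀ {n} {f : Fin n → Fin n} → Injective _≡_ _≡_ f → ∀ j → ∃[ i ] f i ≡ j
injective⇒surjective {suc n} {f} inj j with any? (λ i → f i Fin.≟ j)
... | yes hit = hit
... | no ¬hit = contradiction (injective⇒≤ punched-injective) 1+n≰n
  where
  j≢f : ∀ i → ¬ j ≡ f i
  j≢f i j≡fi = ¬hit (i , sym j≡fi)

  punched-injective : Injective _≡_ _≡_ (λ i → punchOut (j≢f i))
  punched-injective eq = inj (punchOut-injective (j≢f _) (j≢f _) eq)

∣n∧n<m⇒n≡0 : ∀ {m n} → m ∣ n → n < m → n ≡ 0
∣n∧n<m⇒n≡0 {n = zero}  _   _   = refl
∣n∧n<m⇒n≡0 {n = suc _} m∣n n<m = contradiction m∣n (>⇒∤ n<m)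

primeDivisor : ∀ n → 1 < n → ∃[ p ] Prime p × p ∣ n
primeDivisor n@(suc _) 1<n with factorise n
... | record { factors = []     ; isFactorisation = n≡1 }  = contradiction (sym n≡1) (<⇒≢ 1<n)
... | record { factors = p ∷ ps ; isFactorisation = n≡Π ; factorsPrime = p-prime ∷ _ } =
  p , p-prime , subst (p ∣_) (sym n≡Π) (m∣m*n _)

n∣n! : ∀ n .{{_ : NonZero n}} → n ∣ n !
n∣n! (suc n) = m∣m*n (n !)

-- Euclid's argument: a prime divisor of `N ! + 1` that is at most `N` would divide `N !` and hence
-- `1`.
primes-unbounded : ∀ N → ∃[ p ] N < p × Prime p
primes-unbounded N with primeDivisor (suc (N !)) (s≤s (1≤n! N))
... | p , p-prime , p∣1+N! = p , ≰⇒> p≰N , p-prime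
  where
  p≰N : ¬ p ≤ N
  p≰N p≤N = ¬prime[1] (subst Prime (∣1⇒≡1 p∣1) p-prime)
    where
    p∣N! = ∣-trans (n∣n! p {{prime⇒nonZero p-prime}}) (m≤n⇒m!∣n! p≤N)
    p∣1  = ∣m+n∣m⇒∣n (subst (p ∣_) (+-comm 1 (N !)) p∣1+N!) p∣N!

-- Divisors of `2 ^ m * p`.

prime∣2^m*n⇒∣n : ∀ {p} → Prime p → 2 < p → ∀ m {n} → p ∣ 2 ^ m * n → p ∣ n
prime∣2^m*n⇒∣n {p} p-prime 2<p zero    {n} p∣ = subst (p ∣_) (*-identityˡ n) p∣
prime∣2^m*n⇒∣n {p} p-prime 2<p (suc m) {n} p∣
  with euclidsLemma 2 (2 ^ m * n) p-prime (subst (p ∣_) (*-assoc 2 (2 ^ m) n) p∣)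
... | inj₁ p∣2 = contradiction p∣2 (>⇒∤ 2<p)
... | inj₂ p∣′ = prime∣2^m*n⇒∣n p-prime 2<p m p∣′

2∤⇒coprime : ∀ {d} → 2 ∤ d → Coprime d 2
2∤⇒coprime 2∤d (c∣d , c∣2) with prime⇒irreducible prime[2] c∣2
... | inj₁ c≡1  = c≡1
... | inj₂ refl = contradiction c∣d 2∤d

-- Induction on `m`: an odd `d` is coprime to `2` and so divides `2 ^ m * p` already, while an even
-- `d` is halved together with the number it divides.
∣2^m*prime⇒ : ∀ {p} → Prime p → ∀ m {d} → d ∣ 2 ^ m * p →
              ∃[ a ] a ≤ m × (d ≡ 2 ^ a ⊎ d ≡ 2 ^ a * p)
∣2^m*prime⇒ {p} p-prime zero {d} d∣p
  with prime⇒irreducible p-prime (subst (d ∣_) (*-identityˡ p) d∣p)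
... | inj₁ d≡1 = 0 , z≤n , inj₁ d≡1
... | inj₂ d≡p = 0 , z≤n , inj₂ (trans d≡p (sym (*-identityˡ p)))
∣2^m*prime⇒ {p} p-prime (suc m) {d} d∣n with subst (d ∣_) (*-assoc 2 (2 ^ m) p) d∣n | 2 ∣? d
... | d∣2*n′ | no 2∤d
  with a , a≤m , d≡ ← ∣2^m*prime⇒ p-prime m (coprime-divisor (2∤⇒coprime 2∤d) d∣2*n′)
  = a , m≤n⇒m≤1+n a≤m , d≡
... | d∣2*n′ | yes (divides e d≡e*2)
  with a , a≤m , e≡ ← ∣2^m*prime⇒ p-prime m
         (*-cancelˡ-∣ 2 (subst (_∣ 2 * (2 ^ m * p)) (trans d≡e*2 (*-comm e 2)) d∣2*n′))
  = suc a , s≤s a≤m ,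
    [ inj₁ ∘ double , (λ e≡ → inj₂ (trans (double e≡) (sym (*-assoc 2 (2 ^ a) p)))) ]′ e≡
  where
  double : ∀ {e′} → e ≡ e′ → d ≡ 2 * e′
  double e≡e′ = trans d≡e*2 (trans (*-comm e 2) (cong (2 *_) e≡e′))

2^-mono-∣ : ∀ {a b} → a ≤ b → 2 ^ a ∣ 2 ^ b
2^-mono-∣ {b = b} z≤n           = 1∣ (2 ^ b)
2^-mono-∣         (s≤s a≤b) = *-monoʳ-∣ 2 (2^-mono-∣ a≤b)

2^-injective : ∀ {a b} → 2 ^ a ≡ 2 ^ b → a ≡ b
2^-injective {a} {b} eq with <-cmp a b
... | tri< a<b _ _ = contradiction eq (<⇒≢ (^-monoʳ-< 2 (s≤s (s≤s z≤n)) a<b))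
... | tri≈ _ a≡b _ = a≡b
... | tri> _ _ b<a = contradiction (sym eq) (<⇒≢ (^-monoʳ-< 2 (s≤s (s≤s z≤n)) b<a))

2^≢2^*prime : ∀ {p} → Prime p → 2 < p → ∀ a b → ¬ 2 ^ a ≡ 2 ^ b * p
2^≢2^*prime {p} p-prime 2<p a b eq =
  -- Stripping `2 ^ a` from `2 ^ a * 1` would leave `p` dividing `1`.
  contradiction (prime∣2^m*n⇒∣n p-prime 2<p a p∣2^a*1) (>⇒∤ (<-trans (s≤s z<s) 2<p))
  where
  p∣2^a*1 : p ∣ 2 ^ a * 1
  p∣2^a*1 = divides (2 ^ b) (trans (*-identityʳ (2 ^ a)) eq)

-- Congruence of integers.

infix 4 _≋_[_]

-- The membership x ∈ y mod n as a record, so that x, y and n can be inferred from its proofs.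
record _≋_[_] (x y : ℤ) (n : ℕ) : Set where
  constructor mod⇒≋
  field ≋⇒mod : x ∈ y mod n

open _≋_[_]

≋-refl : ∀ {x n} → x ≋ x [ n ]
≋-refl {x} {n} = mod⇒≋ (+ 0 , identity x (+ n))
  where
  identity : ∀ x n → x ≡ x ℤ.+ n ℤ.* + 0
  identity = solve-∀

≋-sym : ∀ {x y n} → x ≋ y [ n ] → y ≋ x [ n ]
≋-sym {y = y} {n} (mod⇒≋ (q , refl)) = mod⇒≋ (ℤ.- q , identity y (+ n) q)
  where
  identity : ∀ y n q → y ≡ y ℤ.+ n ℤ.* q ℤ.+ n ℤ.* (ℤ.- q)
  identity = solve-∀

≋-trans : ∀ {x y z n} → x ≋ y [ n ] → y ≋ z [ n ] → x ≋ z [ n ]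
≋-trans {z = z} {n} (mod⇒≋ (q , refl)) (mod⇒≋ (r , refl)) = mod⇒≋ (r ℤ.+ q , identity z (+ n) q r)
  where
  identity : ∀ z n q r → z ℤ.+ n ℤ.* r ℤ.+ n ℤ.* q ≡ z ℤ.+ n ℤ.* (r ℤ.+ q)
  identity = solve-∀

≋-weaken : ∀ {d n} → d ∣ n → ∀ {x y} → x ≋ y [ n ] → x ≋ y [ d ]
≋-weaken {d} (divides k refl) {y = y} (mod⇒≋ (q , refl)) =
  mod⇒≋ (+ k ℤ.* q , cong (ℤ._+_ y) (trans (cong (ℤ._* q) (ℤ.pos-* k d)) (identity (+ k) (+ d) q)))
  where
  identity : ∀ k d q → k ℤ.* d ℤ.* q ≡ d ℤ.* (k ℤ.* q)
  identity = solve-∀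

+n-≋ : ∀ x n → x ℤ.+ + n ≋ x [ n ]
+n-≋ x n = mod⇒≋ (+ 1 , cong (ℤ._+_ x) (sym (ℤ.*-identityʳ (+ n))))

≋⇒∣ : ∀ {x y n} → x ≋ y [ n ] → n ∣ ∣ x ℤ.- y ∣
≋⇒∣ {y = y} {n} (mod⇒≋ (q , refl)) = divides ∣ q ∣
  (trans (cong ∣_∣ (identity y (+ n) q)) (ℤ.abs-* q (+ n)))
  where
  identity : ∀ y n q → y ℤ.+ n ℤ.* q ℤ.- y ≡ q ℤ.* n
  identity = solve-∀

∣⇒≋ : ∀ {x y n} → n ∣ ∣ x ℤ.- y ∣ → x ≋ y [ n ]
∣⇒≋ {x} {y} {n} n∣ with ℤ∣.divides q x-y≡q*n ← ℤ∣.∣ᵤ⇒∣ {+ n} {x ℤ.- y} n∣ =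
  mod⇒≋ (q , trans (identity x y) (cong (ℤ._+_ y) (trans x-y≡q*n (ℤ.*-comm q (+ n)))))
  where
  identity : ∀ x y → x ≡ y ℤ.+ (x ℤ.- y)
  identity = solve-∀

_≋?_[_] : ∀ x y n → Dec (x ≋ y [ n ])
x ≋? y [ n ] = Dec.map′ ∣⇒≋ ≋⇒∣ (n ∣? ∣ x ℤ.- y ∣)

x+2^m≋̸x : ∀ m x → ¬ x ℤ.+ + (2 ^ m) ≋ x [ 2 ^ suc m ]
x+2^m≋̸x m x x+2^m≋x =
  >⇒∤ {{m^n≢0 2 m}} (^-monoʳ-< 2 (s≤s (s≤s z≤n)) (n<1+n m))
    (subst (λ z → 2 ^ suc m ∣ ∣ z ∣) (identity x (+ (2 ^ m))) (≋⇒∣ x+2^m≋x))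
  where
  identity : ∀ x y → x ℤ.+ y ℤ.- x ≡ y
  identity = solve-∀

-- Integers missed by the classes whose moduli are powers of two.

-- The exponents start at 1, so the moduli concerned are `2`, ..., `2 ^ c`. All of them divide
-- `2 ^ c`, so the property depends only on `x` modulo `2 ^ c`.
Avoids : ∀ {k} → System k → ℕ → ℤ → Set
Avoids S c x = ∀ i b → b < c → modulus S i ≡ 2 ^ suc b → ¬ x ≋ residue S i [ modulus S i ]

open ≡-Reasoning

module _ {k} (S : System k) where

  avoids-resp-≋ : ∀ {c x y} → Avoids S c x → y ≋ x [ 2 ^ c ] → Avoids S c y
  avoids-resp-≋ {c} avoids y∈x i b b<c eq y∈i =
    avoids i b b<c eq (≋-trans (≋-sym (≋-weaken modulus∣2^c y∈x)) y∈i)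
    where
    modulus∣2^c : modulus S i ∣ 2 ^ c
    modulus∣2^c = subst (_∣ 2 ^ c) (sym eq) (2^-mono-∣ b<c)

  avoids-suc : ∀ {c x} → Avoids S c x →
               (∀ i → modulus S i ≡ 2 ^ suc c → ¬ x ≋ residue S i [ modulus S i ]) →
               Avoids S (suc c) x
  avoids-suc avoids avoids-c i b b<1+c with m<1+n⇒m<n∨m≡n b<1+c
  ... | inj₁ b<c  = avoids i b b<c
  ... | inj₂ refl = avoids-c i

  module _ (distinct : DistinctModuli S) where

    -- This replaces the density count by a choice at each level: the only class that can have
    -- modulus `2 ^ suc c` does not contain both `x` and `x + 2 ^ c`, and these agree modulo
    -- `2 ^ c`.
    avoids-step : ∀ {c x} → Avoids S c x → ∃[ y ] y ≋ x [ 2 ^ c ] × Avoids S (suc c) y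
    avoids-step {c} {x} avoids with any? (λ i → modulus S i ≟ 2 ^ suc c)
    ... | no ¬∃i = x , ≋-refl , avoids-suc avoids (λ i eq _ → ¬∃i (i , eq))
    ... | yes (i , eqᵢ) with x ≋? residue S i [ modulus S i ]
    ...   | no x∉ = x , ≋-refl , avoids-suc avoids avoids-c
      where
      avoids-c : ∀ j → modulus S j ≡ 2 ^ suc c → ¬ x ≋ residue S j [ modulus S j ]
      avoids-c j eqⱼ with refl ← distinct (trans eqⱼ (sym eqᵢ)) = x∉
    ...   | yes x∈ = x′ , x′∈x , avoids-suc (avoids-resp-≋ avoids x′∈x) avoids-c
      where
      x′ = x ℤ.+ + (2 ^ c)

      x′∈x : x′ ≋ x [ 2 ^ c ]
      x′∈x = +n-≋ x (2 ^ c)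

      avoids-c : ∀ j → modulus S j ≡ 2 ^ suc c → ¬ x′ ≋ residue S j [ modulus S j ]
      avoids-c j eqⱼ x′∈ with refl ← distinct (trans eqⱼ (sym eqᵢ)) =
        x+2^m≋̸x c x
          (subst (x′ ≋ x [_]) eqᵢ (≋-trans x′∈ (≋-sym x∈)))

    avoids-extend : ∀ d {c x} → Avoids S c x → ∃[ y ] y ≋ x [ 2 ^ c ] × Avoids S (d + c) y
    avoids-extend zero            avoids = _ , ≋-refl , avoids
    avoids-extend (suc d) {c} avoids
      with y , y∈x , avoids-y ← avoids-extend d avoids
      with z , z∈y , avoids-z ← avoids-step avoids-y
      = z , ≋-trans (≋-weaken (2^-mono-∣ (m≤n+m c d)) z∈y) y∈x , avoids-z

    avoids-extend-≤ : ∀ {c m x} → c ≤ m → Avoids S c x → ∃[ y ] y ≋ x [ 2 ^ c ] × Avoids S m y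
    avoids-extend-≤ {c} {m} {x} c≤m avoids =
      subst (λ e → ∃[ y ] y ≋ x [ 2 ^ c ] × Avoids S e y) (m∸n+n≡m c≤m)
        (avoids-extend (m ∸ c) avoids)

    hole : ∀ c → ∃[ x ] Avoids S c x
    -- At level `0` there is nothing to avoid, so any integer can start the extension; `+ 0` is
    -- chosen.
    hole c with x , _ , avoids ← avoids-extend-≤ {0} {c} {+ 0} z≤n (λ _ _ ()) = x , avoids

module _ {m} (p-prime : Prime (suc m)) (2<p : 2 < suc m) where

  private
    p = suc m

  -- Every divisor in `D (2 ^ m * p)` is forced as a modulus.

  module _ {k} {S : System k} (cover : IsCover S) (distinct : DistinctModuli S)
           (moduli⊆D : Moduli S ⊆ D (2 ^ m * p)) where

    private
      shift : ℤ → ℕ → ℤ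
      shift x t = x ℤ.+ + (2 ^ m) ℤ.* + t

      shift≋ : ∀ x t → shift x t ≋ x [ 2 ^ m ]
      shift≋ x t = mod⇒≋ (+ t , refl)

      -- The two shifts differ by `2 ^ m * (s - t)`. The odd prime `p` must divide `s - t`, whose
      -- absolute value is below `p`.
      shift-injective : ∀ x {s t} → s < p → t < p → shift x s ≋ shift x t [ p ] → s ≡ t
      shift-injective x {s} {t} s<p t<p s≋t =
        ℤ.+-injective (ℤ.i-j≡0⇒i≡j (+ s) (+ t) (ℤ.∣i∣≡0⇒i≡0 (∣n∧n<m⇒n≡0 p∣s-t s-t<p)))
        where
        identity : ∀ x c s t → x ℤ.+ c ℤ.* s ℤ.- (x ℤ.+ c ℤ.* t) ≡ c ℤ.* (s ℤ.- t)
        identity = solve-∀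

        p∣s-t : p ∣ ∣ + s ℤ.- + t ∣
        p∣s-t = prime∣2^m*n⇒∣n p-prime 2<p m
          (subst (p ∣_) (trans (cong ∣_∣ (identity x (+ (2 ^ m)) (+ s) (+ t)))
                               (ℤ.abs-* (+ (2 ^ m)) (+ s ℤ.- + t)))
            (≋⇒∣ s≋t))

        s-t<p : ∣ + s ℤ.- + t ∣ < p
        s-t<p = subst (λ z → ∣ z ∣ < p) (sym (ℤ.m-n≡m⊖n s t))
          (≤-<-trans (ℤ.∣m⊝n∣≤m⊔n s t) (⊔-pres-<m s<p t<p))

    -- The shift agrees with `x` modulo `2 ^ m`, so it too avoids the powers of two from `2` to
    -- `2 ^ m`; the modulus `1` is excluded by `2 ≤ d`.
    hit : ∀ {x} → Avoids S m x → ∀ t →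
          ∃[ b ] ∃[ i ] b ≤ m × modulus S i ≡ 2 ^ b * p × shift x t ≋ residue S i [ modulus S i ]
    hit {x} avoids t with cover (shift x t)
    ... | i , t∈ with moduli⊆D (i , refl)
    ...   | 2≤d , d∣n with ∣2^m*prime⇒ p-prime m d∣n
    ...     | zero  , _   , inj₁ d≡1     = contradiction (subst (2 ≤_) d≡1 2≤d) 1+n≰n
    ...     | suc a , a<m , inj₁ d≡2^1+a =
      contradiction (mod⇒≋ t∈) (avoids-resp-≋ S avoids (shift≋ x t) i a a<m d≡2^1+a)
    ...     | b     , b≤m , inj₂ d≡2^b*p = b , i , b≤m , d≡2^b*p , mod⇒≋ t∈

    -- The choice `p = m + 1` matters here: there are as many shifts as exponents `b ≤ m`. Two
    -- shifts with equal exponent would share a class and agree modulo `p`, so `exponent` is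
    -- injective and therefore takes every value.
    avoids⇒modulus : ∀ {x} → Avoids S m x → ∀ {b} → b ≤ m →
                     ∃[ i ] modulus S i ≡ 2 ^ b * p × x ≋ residue S i [ 2 ^ b ]
    avoids⇒modulus {x} avoids {b} b≤m =
      from-hit (injective⇒surjective exponent-injective (fromℕ< (s≤s b≤m)))
      where
      exponent : Fin p → Fin p
      exponent t = let _ , _ , b≤m , _ = hit avoids (toℕ t) in fromℕ< (s≤s b≤m)

      exponent-injective : Injective _≡_ _≡_ exponent
      exponent-injective {s} {t} eq
        with b , i , b≤m , d≡ , s∈ ← hit avoids (toℕ s)
           | c , j , c≤m , e≡ , t∈ ← hit avoids (toℕ t)
        with refl ← Fin.fromℕ<-injective _ _ _ _ eq
        with refl ← distinct (trans d≡ (sym e≡))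
        = toℕ-injective (shift-injective x (toℕ<n s) (toℕ<n t)
            (≋-weaken (subst (p ∣_) (sym d≡) (n∣m*n (2 ^ b))) (≋-trans s∈ (≋-sym t∈))))

      from-hit : ∃[ t ] exponent t ≡ fromℕ< (s≤s b≤m) →
                 ∃[ i ] modulus S i ≡ 2 ^ b * p × x ≋ residue S i [ 2 ^ b ]
      from-hit (t , eq)
        with c , i , c≤m , d≡ , t∈ ← hit avoids (toℕ t)
        with refl ← Fin.fromℕ<-injective _ _ _ _ eq
        -- The shift is congruent to `x` modulo `2 ^ m`, hence modulo `2 ^ b`, and `2 ^ b` divides
        -- the modulus of the class that contains it.
        = i , d≡ , ≋-trans (≋-weaken (2^-mono-∣ b≤m) (≋-sym (shift≋ x (toℕ t))))
                           (≋-weaken (subst (2 ^ b ∣_) (sym d≡) (m∣m*n p)) t∈)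

    -- Taking `b = m` in `avoids⇒modulus` gives the same class for `x` and `y`, by distinctness.
    avoids-unique : ∀ {x y} → Avoids S m x → Avoids S m y → x ≋ y [ 2 ^ m ]
    avoids-unique avoids-x avoids-y
      with i , d≡ , x∈ ← avoids⇒modulus avoids-x ≤-refl
         | j , e≡ , y∈ ← avoids⇒modulus avoids-y ≤-refl
      with refl ← distinct (trans d≡ (sym e≡))
      = ≋-trans x∈ (≋-sym y∈)

    2^-modulus : ∀ {a} → a < m → ∃[ i ] modulus S i ≡ 2 ^ suc a
    2^-modulus {a} a<m with any? (λ i → modulus S i ≟ 2 ^ suc a)
    ... | yes ∃i = ∃i
    ... | no ¬∃i
      -- With no class of modulus `2 ^ suc a`, both `x` and `x + 2 ^ a` pass to level `suc a`
      -- unchanged. Their extensions `y` and `z` to level `m` keep them apart modulo `2 ^ suc a`,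
      -- against uniqueness.
      with x , avoids-x ← hole S distinct a
      with y , y≋x , avoids-y ← avoids-extend-≤ S distinct a<m
             (avoids-suc S avoids-x (λ i eq _ → ¬∃i (i , eq)))
         | z , z≋x′ , avoids-z ← avoids-extend-≤ S distinct a<m
             (avoids-suc S (avoids-resp-≋ S avoids-x (+n-≋ x (2 ^ a))) (λ i eq _ → ¬∃i (i , eq)))
      = contradiction
          (≋-trans (≋-sym z≋x′)
            (≋-trans (≋-weaken (2^-mono-∣ a<m) (avoids-unique avoids-z avoids-y)) y≋x))
          (x+2^m≋̸x a x)

    D⊆moduli : D (2 ^ m * p) ⊆ Moduli S
    D⊆moduli (2≤d , d∣n) with ∣2^m*prime⇒ p-prime m d∣n
    ... | zero  , _   , inj₁ refl = contradiction 2≤d 1+n≰n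
    ... | suc a , a<m , inj₁ refl = 2^-modulus a<m
    ... | b     , b≤m , inj₂ refl =
      let _ , avoids = hole S distinct m
          i , d≡ , _ = avoids⇒modulus avoids b≤m
      in i , d≡

  -- A cover whose moduli are exactly `D (2 ^ m * p)`.

  private
    Index = Fin m ⊎ Fin p

    indexedModulus : Index → ℕ
    indexedModulus = [ (λ i → 2 ^ suc (toℕ i)) , (λ j → 2 ^ toℕ j * p) ]′

    indexedResidue : Index → ℤ
    indexedResidue = [ (λ i → + (2 ^ toℕ i)) , (λ j → + (2 ^ m) ℤ.* + toℕ j) ]′

    indexedModulus>0 : ∀ i → 0 < indexedModulus i
    indexedModulus>0 (inj₁ i) = m^n>0 2 (suc (toℕ i))
    indexedModulus>0 (inj₂ j) = *-mono-< (m^n>0 2 (toℕ j)) z<s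

    indexedModulus-injective : Injective _≡_ _≡_ indexedModulus
    indexedModulus-injective {inj₁ i} {inj₁ j} eq =
      cong inj₁ (toℕ-injective (suc-injective (2^-injective eq)))
    indexedModulus-injective {inj₁ i} {inj₂ j} eq =
      contradiction eq (2^≢2^*prime p-prime 2<p (suc (toℕ i)) (toℕ j))
    indexedModulus-injective {inj₂ i} {inj₁ j} eq =
      contradiction (sym eq) (2^≢2^*prime p-prime 2<p (suc (toℕ j)) (toℕ i))
    indexedModulus-injective {inj₂ i} {inj₂ j} eq =
      cong inj₂ (toℕ-injective (2^-injective (*-cancelʳ-≡ _ _ p eq)))

    IndexedCover : ℤ → Set
    IndexedCover z = ∃[ i ] z ≋ indexedResidue i [ indexedModulus i ]

    -- Write `z = 2 ^ c * w`. An odd `w` puts `z` in the class of `2 ^ c` modulo `2 ^ suc c`; an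
    -- even `w` yields one more factor `2`.
    covered⊎≋0 : ∀ {c} → c ≤ m → ∀ z → IndexedCover z ⊎ z ≋ + 0 [ 2 ^ c ]
    covered⊎≋0 {zero}  _   z = inj₂ (mod⇒≋ (z , identity z))
      where
      identity : ∀ z → z ≡ + 0 ℤ.+ + 1 ℤ.* z
      identity = solve-∀
    covered⊎≋0 {suc c} c<m z with covered⊎≋0 (<⇒≤ c<m) z
    ... | inj₁ covered = inj₁ covered
    ... | inj₂ (mod⇒≋ (w , z≡2^c*w)) with w %ℕ 2 | n%ℕd<d w 2 | a≡a%ℕn+[a/ℕn]*n w 2
    ...   | 0 | _ | w≡2q = inj₂ (mod⇒≋ (w /ℕ 2 , z≡))
      where
      identity : ∀ c q → + 0 ℤ.+ c ℤ.* (+ 0 ℤ.+ q ℤ.* + 2) ≡ + 0 ℤ.+ + 2 ℤ.* c ℤ.* q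
      identity = solve-∀

      z≡ : z ≡ + 0 ℤ.+ + (2 ^ suc c) ℤ.* (w /ℕ 2)
      z≡ = begin
        z                                              ≡⟨ z≡2^c*w ⟩
        + 0 ℤ.+ + (2 ^ c) ℤ.* w                        ≡⟨ cong (λ v → + 0 ℤ.+ + (2 ^ c) ℤ.* v) w≡2q ⟩
        + 0 ℤ.+ + (2 ^ c) ℤ.* (+ 0 ℤ.+ w /ℕ 2 ℤ.* + 2)  ≡⟨ identity (+ (2 ^ c)) (w /ℕ 2) ⟩
        + 0 ℤ.+ + 2 ℤ.* + (2 ^ c) ℤ.* (w /ℕ 2)         ≡⟨ cong (λ n → + 0 ℤ.+ n ℤ.* (w /ℕ 2)) (ℤ.pos-* 2 (2 ^ c)) ⟨
        + 0 ℤ.+ + (2 ^ suc c) ℤ.* (w /ℕ 2)             ∎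
    ...   | 1 | _ | w≡1+2q =
      inj₁ (inj₁ (fromℕ< c<m) ,
            subst (λ i → z ≋ + (2 ^ i) [ 2 ^ suc i ]) (sym (toℕ-fromℕ< c<m)) (mod⇒≋ (w /ℕ 2 , z≡)))
      where
      identity : ∀ c q → + 0 ℤ.+ c ℤ.* (+ 1 ℤ.+ q ℤ.* + 2) ≡ c ℤ.+ + 2 ℤ.* c ℤ.* q
      identity = solve-∀

      z≡ : z ≡ + (2 ^ c) ℤ.+ + (2 ^ suc c) ℤ.* (w /ℕ 2)
      z≡ = begin
        z                                              ≡⟨ z≡2^c*w ⟩
        + 0 ℤ.+ + (2 ^ c) ℤ.* w                        ≡⟨ cong (λ v → + 0 ℤ.+ + (2 ^ c) ℤ.* v) w≡1+2q ⟩
        + 0 ℤ.+ + (2 ^ c) ℤ.* (+ 1 ℤ.+ w /ℕ 2 ℤ.* + 2)  ≡⟨ identity (+ (2 ^ c)) (w /ℕ 2) ⟩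
        + (2 ^ c) ℤ.+ + 2 ℤ.* + (2 ^ c) ℤ.* (w /ℕ 2)   ≡⟨ cong (λ n → + (2 ^ c) ℤ.+ n ℤ.* (w /ℕ 2)) (ℤ.pos-* 2 (2 ^ c)) ⟨
        + (2 ^ c) ℤ.+ + (2 ^ suc c) ℤ.* (w /ℕ 2)       ∎
    ...   | suc (suc _) | s≤s (s≤s ()) | _

    indexedCover : ∀ z → IndexedCover z
    indexedCover z with covered⊎≋0 ≤-refl z
    ... | inj₁ covered = covered
    ... | inj₂ (mod⇒≋ (w , z≡2^m*w)) = 
      inj₂ j ,
      -- The congruence is proved modulo the larger `2 ^ m * p`; since `j ≤ m`, it descends to the
      -- modulus `2 ^ j * p` of class `j`.
      ≋-weaken (*-monoˡ-∣ p (2^-mono-∣ (s≤s⁻¹ (toℕ<n j))))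
        (subst (λ i → z ≋ + (2 ^ m) ℤ.* + i [ 2 ^ m * p ]) (sym (toℕ-fromℕ< (n%ℕd<d w p)))
          (mod⇒≋ (w /ℕ p , z≡)))
      where
      j = fromℕ< (n%ℕd<d w p)

      identity : ∀ c r q p → + 0 ℤ.+ c ℤ.* (r ℤ.+ q ℤ.* p) ≡ c ℤ.* r ℤ.+ c ℤ.* p ℤ.* q
      identity = solve-∀

      z≡ : z ≡ + (2 ^ m) ℤ.* + (w %ℕ p) ℤ.+ + (2 ^ m * p) ℤ.* (w /ℕ p)
      z≡ = begin
        z
          ≡⟨ z≡2^m*w ⟩
        + 0 ℤ.+ + (2 ^ m) ℤ.* w
          ≡⟨ cong (λ v → + 0 ℤ.+ + (2 ^ m) ℤ.* v) (a≡a%ℕn+[a/ℕn]*n w p) ⟩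
        + 0 ℤ.+ + (2 ^ m) ℤ.* (+ (w %ℕ p) ℤ.+ w /ℕ p ℤ.* + p)
          ≡⟨ identity (+ (2 ^ m)) (+ (w %ℕ p)) (w /ℕ p) (+ p) ⟩
        + (2 ^ m) ℤ.* + (w %ℕ p) ℤ.+ + (2 ^ m) ℤ.* + p ℤ.* (w /ℕ p)
          ≡⟨ cong (λ n → + (2 ^ m) ℤ.* + (w %ℕ p) ℤ.+ n ℤ.* (w /ℕ p)) (ℤ.pos-* (2 ^ m) p) ⟨
        + (2 ^ m) ℤ.* + (w %ℕ p) ℤ.+ + (2 ^ m * p) ℤ.* (w /ℕ p)
          ∎

  D-isModuliSet : IsModuliSetOfDistinctCover (D (2 ^ m * p))
  D-isModuliSet = m + p , S , cover , distinct , D⊆ , ⊆D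
    where
    S : System (m + p)
    S = record
      { residue   = indexedResidue ∘ splitAt m
      ; modulus   = indexedModulus ∘ splitAt m
      ; modulus>0 = indexedModulus>0 ∘ splitAt m
      }

    cover : IsCover S
    cover z with i , z∈ ← indexedCover z =
      join m p i ,
      subst (λ i → z ∈ indexedResidue i mod indexedModulus i) (sym (splitAt-join m p i)) (≋⇒mod z∈)

    distinct : DistinctModuli S
    distinct {i} {j} eq = trans (sym (join-splitAt m p i))
      (trans (cong (join m p) (indexedModulus-injective {splitAt m i} {splitAt m j} eq)) (join-splitAt m p j))

    fromIndex : ∀ {d} i → indexedModulus i ≡ d → Moduli S d
    fromIndex i eq = join m p i , trans (cong indexedModulus (splitAt-join m p i)) eq

    D⊆ : D (2 ^ m * p) ⊆ Moduli S
    D⊆ (2≤d , d∣n) with ∣2^m*prime⇒ p-prime m d∣n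
    ... | zero  , _   , inj₁ refl = contradiction 2≤d 1+n≰n
    ... | suc a , a<m , inj₁ refl = fromIndex (inj₁ (fromℕ< a<m))
                                              (cong (λ i → 2 ^ suc i) (toℕ-fromℕ< a<m))
    ... | b     , b≤m , inj₂ refl =
      fromIndex (inj₂ (fromℕ< (s≤s b≤m))) (cong (λ j → 2 ^ j * p) (toℕ-fromℕ< (s≤s b≤m)))

    indexedModulus∈D : ∀ i → indexedModulus i ∈ D (2 ^ m * p)
    indexedModulus∈D (inj₁ i) =
      ∣⇒≤ {{m^n≢0 2 (suc (toℕ i))}} (m∣m*n (2 ^ toℕ i)) , ∣m⇒∣m*n p (2^-mono-∣ (toℕ<n i))
    indexedModulus∈D (inj₂ j) =
      ≤-trans (<⇒≤ 2<p) (m≤n*m p (2 ^ toℕ j) {{m^n≢0 2 (toℕ j)}}) ,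
      *-monoˡ-∣ p (2^-mono-∣ (s≤s⁻¹ (toℕ<n j)))

    ⊆D : Moduli S ⊆ D (2 ^ m * p)
    ⊆D (i , refl) = indexedModulus∈D (splitAt m i)

  D-minimal : ∀ (M : Pred ℕ 0ℓ) → M ⊂ D (2 ^ m * p) → ¬ IsModuliSetOfDistinctCover M
  D-minimal M (M⊆D , D⊈M) (k , S , cover , distinct , M⊆S , S⊆M) =
    -- The cover has all of `D` among its moduli, so `D ⊆ M`, against properness.
    D⊈M (S⊆M ∘ D⊆moduli {S = S} cover distinct (M⊆D ∘ S⊆M))

corollary1p3 : InfinitelyMany (λ n →
    0 < n
    × IsModuliSetOfDistinctCover (D n)
    × (∀ (M : Pred ℕ 0ℓ) → M ⊂ D n → ¬ IsModuliSetOfDistinctCover M))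
-- The bound `N + 2` serves twice: it makes `p` odd through `2 < p`, and it gives `N < n` because
-- `p ≤ n`.
corollary1p3 N with primes-unbounded (N + 2)
... | suc m , N+2<p , p-prime =
  2 ^ m * p , ≤-<-trans (m≤m+n N 2) N+2<n , ≤-<-trans z≤n N+2<n ,
  D-isModuliSet p-prime 2<p , D-minimal p-prime 2<p
  where
  p = suc m

  2<p : 2 < p
  2<p = ≤-<-trans (m≤n+m 2 N) N+2<p

  N+2<n : N + 2 < 2 ^ m * p
  N+2<n = <-≤-trans N+2<p (m≤n*m p (2 ^ m) {{m^n≢0 2 m}})
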